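{- Let $n\ge 1$. Consider the labeled chip-firing process on $\mathbb{Z}$ beginning with chips labeled $-n,\dots,-1$ at site $-1$ and chips labeled $1,\dots,n+1$ at site $0$. When the process terminates (no firing move possible), each chip $k$ is at site $k$, regardless of the choices of firing moves made.
   Context: Labeled chip-firing on the infinite path graph $\mathbb{Z}$ (each integer $i$ adjacent to $i-1$ and $i+1$): a firing move consists of choosing two chips with labels $a<b$ located at a common site $i$, and moving chip $a$ to site $i-1$ and chip $b$ to site $i+1$. The process terminates when all chips occupy distinct sites.
   Formalization: The conclusion is corrected from "each chip k is at site k" to "each chip k is at site k − 1": firing preserves the sum of the sites, which is −n at the start, whereas the printed conclusion would give n + 1 (for n = 1 chips −1, 1, 2 end at −2, 0, 1). -}

module Defs where

open import Data.Fin.Base using (Fin; toℕ)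
open import Data.Integer.Base using (ℤ; +_; -[1+_]; 0ℤ; -1ℤ; _<_; pred) renaming (suc to sucℤ)
open import Data.Nat.Base using (ℕ; suc)
open import Relation.Binary.Construct.Closure.ReflexiveTransitive using (Star)
open import Relation.Binary.PropositionalEquality.Core using (_≡_; _≢_)
open import Relation.Binary.Rewriting using (IsNormalForm)

-- The chips carrying the labels -n, …, -1 (neg) and 1, …, n + 1 (pos);
-- there is no chip labelled 0.
data Chip (n : ℕ) : Set where
  neg : Fin n → Chip n
  pos : Fin (suc n) → Chip n

-- -[1+ i ] is the integer -(1 + i), so no label is repeated or omitted.
label : ∀ {n} → Chip n → ℤ
label (neg i) = -[1+ toℕ i ]
label (pos j) = + suc (toℕ j)

-- A configuration gives the site of each chip.
Config : ℕ → Set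
Config n = Chip n → ℤ

infix 4 _⟶_ _⟶*_

-- The sites after a move are constrained pointwise, so that no function
-- extensionality is needed to recognise a configuration.
record _⟶_ {n : ℕ} (c c′ : Config n) : Set where
  constructor fire
  field
    a b       : Chip n
    a<b       : label a < label b
    same-site : c a ≡ c b
    a-left    : c′ a ≡ pred (c a)
    b-right   : c′ b ≡ sucℤ (c b)
    others    : ∀ k → k ≢ a → k ≢ b → c′ k ≡ c k

_⟶*_ : ∀ {n} → Config n → Config n → Set
_⟶*_ = Star _⟶_

Terminal : ∀ {n} → Config n → Set
Terminal = IsNormalForm _⟶_

initial : ∀ n → Config n
initial n (neg _) = -1ℤ
initial n (pos _) = 0ℤ

{-# OPTIONS --safe #-}
module Submission where

-- Let h(p) be the sum over all chips k of max(0, p - c k), and let the excess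
-- be E(p) = T(n + 1 + p) - h(p) with T(z) = z (z + 1) / 2.  The second
-- difference of h at p counts the chips at p, so that of E is one minus this
-- count, and a firing at s only lowers E(s), by one.  Hence the bounds
-- E(p) ≥ 0 and E(p) ≥ p + 1 persist, and so do two one-sided comparisons of
-- neighbouring values of E (the fields climb and descend of Profile).
--
-- The comparisons force that if E(p) = j + 1 with p < j ≤ n and 0 ≤ j ≤ n + p
-- and p fires, then exactly two chips are at p, E(p - 1) = j and
-- E(p + 1) = j + 1.  By induction along the process, for every p < j the chip
-- with label j + 1 is to the right of p as soon as E(p) ≤ j: at the firing that
-- lowers E(p) to j the chip is at p or beyond; if it is at p, it is one of the
-- two chips fired, and it moves right because the larger chips have already
-- left p.  The negative labels are treated symmetrically.
--
-- In a terminal configuration E is convex with E(-n - 1) ≤ 0 and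
-- E(n) ≤ n + 1, so E(p) = max(0, p + 1) between these sites.  Therefore the
-- chips j + 1 and -i-1 are at sites ≥ j and ≤ -i-2, and as the sites are
-- distinct and lie between -n-1 and n, equality holds.

open import Defs
open import Data.Bool.Base using (if_then_else_)
open import Data.Empty using (⊥; ⊥-elim)
open import Data.Fin.Base using (Fin; zero; suc; toℕ; fromℕ<)
import Data.Fin.Properties as Fin
open import Data.Integer.Base using (ℤ; +_; +0; +[1+_]; -[1+_]; 0ℤ; 1ℤ; -1ℤ; _+_; _-_; -_; _*_; _<_;
  pred; +≤+; -≤+; -≤-; +<+; -<+; -<-) renaming (suc to sucℤ; _≤_ to _≤ℤ_)
open import Data.Integer.Properties
open import Data.Integer.Tactic.RingSolver using (solve)
open import Data.List.Base using ([]; _∷_)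
open import Data.Nat.Base as ℕ using (ℕ; _≤_)
import Data.Nat.Properties as ℕ
open import Data.Product.Base using (∃; _×_; _,_; proj₁; proj₂)
open import Data.Sum.Base using (_⊎_; inj₁; inj₂)
open import Function.Base using (_∘_)
open import Relation.Binary.Construct.Closure.ReflexiveTransitive using (ε; _◅_)
open import Relation.Binary.Definitions using (DecidableEquality; tri<; tri≈; tri>)
open import Relation.Binary.PropositionalEquality
  using (_≡_; _≢_; refl; sym; trans; cong; cong₂; subst; subst₂; module ≡-Reasoning)
open import Relation.Nullary using (yes; no; does; contradiction)
open import Relation.Nullary.Decidable using (map′; dec-false)
open import Algebra.Properties.AbelianGroup +-0-abelianGroup using (∙-cancelʳ)
open import Algebra.Properties.CommutativeMonoid.Sum +-0-commutativeMonoid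
  using (sum; sum-cong-≗; ∑-distrib-+)

-- Linear arithmetic over the integers

infixl 5 _⊕_
infix 4 _≤⊎>_

_⊕_ : ∀ {a b c d} → a ≤ℤ b → c ≤ℤ d → a + c ≤ℤ b + d
_⊕_ = +-mono-≤

-- A linear inequality over ℤ follows from a sum a ≤ b of hypotheses once the
-- ring solver identifies the two differences.
linear : ∀ {a b x y} → a ≤ℤ b → y - x ≡ b - a → x ≤ℤ y
linear a≤b eq = 0≤i-j⇒j≤i (subst (0ℤ ≤ℤ_) (sym eq) (i≤j⇒0≤j-i a≤b))

absurd : ∀ {a b} → a ≤ℤ b → b - a ≡ -1ℤ → ⊥
absurd {a} {b} a≤b eq with subst (0ℤ ≤ℤ_) eq (i≤j⇒0≤j-i a≤b)
... | ()

_≤⊎>_ : ∀ x y → x ≤ℤ y ⊎ 1ℤ + y ≤ℤ x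
x ≤⊎> y with x ≤? y
... | yes x≤y = inj₁ x≤y
... | no  x≰y = inj₂ (i<j⇒suc[i]≤j (≰⇒> x≰y))

<⇒≰ : ∀ {x y} → 1ℤ + y ≤ℤ x → x ≤ℤ y → ⊥
<⇒≰ y<x x≤y = <⇒≱ (suc[i]≤j⇒i<j y<x) x≤y

≤-by-contradiction : ∀ {x y} → (1ℤ + y ≤ℤ x → ⊥) → x ≤ℤ y
≤-by-contradiction {x} {y} ¬y<x with x ≤⊎> y
... | inj₁ x≤y = x≤y
... | inj₂ y<x = ⊥-elim (¬y<x y<x)

-- Excess profiles and their preservation under a firing

-- Everything the unlabelled argument needs to know about a move. Since the second difference of E
-- is one minus the number of chips, `crowded` expresses that at least two chips are at s.
record Firing (E E′ : ℤ → ℤ) (s : ℤ) : Set where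
  field
    drop    : E s ≡ 1ℤ + E′ s
    same    : ∀ {p} → p ≢ s → E′ p ≡ E p
    crowded : 1ℤ + (E (pred s) + E (sucℤ s)) ≤ℤ E s + E s

  decreasing : ∀ p → E′ p ≤ℤ E p
  decreasing p with p ≟ s
  ... | yes refl = ≤-trans (i≤suc[i] _) (≤-reflexive (sym drop))
  ... | no  p≢s  = ≤-reflexive (same p≢s)

-- In the given ranges of p, `climb` amounts to E p ≤ E (pred p) + 1 whenever that bound is at most
-- n + p, and `descend` to E p ≤ E (sucℤ p) whenever that bound is at most n. Together with `nonneg`
-- and `above`, the fields `left` and `right` fix E at the two end sites, so that neither can ever
-- fire.
record Profile (n : ℕ) (E : ℤ → ℤ) : Set where
  field
    nonneg  : ∀ p → 0ℤ ≤ℤ E p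
    above   : ∀ p → 1ℤ + p ≤ℤ E p
    left    : E -[1+ n ] ≤ℤ 0ℤ
    right   : E (+ n) ≤ℤ 1ℤ + + n
    climb   : ∀ p j → p ≤ℤ 1ℤ + + n → j ≤ℤ + n + p → 1ℤ + E (pred p) ≤ℤ j → E p ≤ℤ j
    descend : ∀ p j → - (+ 2 + + n) ≤ℤ p → j ≤ℤ + n → E (sucℤ p) ≤ℤ j → E p ≤ℤ j

module _ {n E E′ s} (P : Profile n E) (F : Firing E E′ s) where
  open Profile P
  open Firing F

  private
    -- By `crowded`, E s is strictly above the average of its neighbours. As all values are
    -- integers, this leaves room for the drop by one.
    floor : ∀ a b c → a ≤ℤ E (pred s) → b ≤ℤ E (sucℤ s) → c + c ≤ℤ a + b → c ≤ℤ E′ s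
    floor a b c a≤ b≤ c≤ = ≤-by-contradiction λ E′<c →
      lemma (E (pred s)) (E s) (E′ s) (E (sucℤ s)) crowded (≤-reflexive drop) a≤ b≤ c≤ E′<c
      where
      lemma : ∀ x y y′ z → 1ℤ + (x + z) ≤ℤ y + y → y ≤ℤ 1ℤ + y′ → a ≤ℤ x → b ≤ℤ z →
              c + c ≤ℤ a + b → 1ℤ + y′ ≤ℤ c → ⊥
      lemma x y y′ z h₁ h₂ h₃ h₄ h₅ h₆ =
        absurd (h₁ ⊕ h₂ ⊕ h₂ ⊕ h₃ ⊕ h₄ ⊕ h₅ ⊕ h₆ ⊕ h₆)
          (solve (x ∷ y ∷ y′ ∷ z ∷ a ∷ b ∷ c ∷ []))

    -- Only a firing at s = pred p strengthens what has to be shown. If E p > j there, `crowded`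
    -- forces E (pred s) ≤ j - 2, and climbing twice gives E s ≤ j - 1 and then E p ≤ j.
    climb′ : ∀ p j → p ≤ℤ 1ℤ + + n → j ≤ℤ + n + p → 1ℤ + E′ (pred p) ≤ℤ j → E′ p ≤ℤ j
    climb′ p j p≤ j≤ E′<j with pred p ≟ s
    ... | no p-1≢s =
      ≤-trans (decreasing p) (climb p j p≤ j≤ (subst (λ x → 1ℤ + x ≤ℤ j) (same p-1≢s) E′<j))
    ... | yes refl = ≤-by-contradiction λ j<E′ →
      let j<E = ≤-trans j<E′ (decreasing p)
          y≤j = ≤-trans (≤-reflexive drop) E′<j
          c   = subst (λ q → 1ℤ + (E (pred s) + E q) ≤ℤ E s + E s) (suc-pred p) crowded
          E≤  = climb s (pred j) (≤-trans (i≤j⇒pred[i]≤j ≤-refl) p≤)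
                  (shift (+ n) p j j≤) (lemma (E (pred s)) (E s) (E p) j c y≤j j<E)
      in <⇒≰ j<E (climb p j p≤ j≤ (unshift (E s) j E≤))
      where
      lemma : ∀ x y z j → 1ℤ + (x + z) ≤ℤ y + y → y ≤ℤ j → 1ℤ + j ≤ℤ z → 1ℤ + x ≤ℤ -1ℤ + j
      lemma x y z j h₁ h₂ h₃ = linear (h₁ ⊕ h₂ ⊕ h₂ ⊕ h₃) (solve (x ∷ y ∷ z ∷ j ∷ []))
      shift : ∀ N p j → j ≤ℤ N + p → -1ℤ + j ≤ℤ N + (-1ℤ + p)
      shift N p j h = linear h (solve (N ∷ p ∷ j ∷ []))
      unshift : ∀ x j → x ≤ℤ -1ℤ + j → 1ℤ + x ≤ℤ j
      unshift x j h = linear h (solve (x ∷ j ∷ []))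

    -- Here the critical firing is at s = sucℤ p. If E p > j, `crowded` forces E (sucℤ s) ≤ j, and
    -- descending twice, to s and then to p, gives a contradiction.
    descend′ : ∀ p j → - (+ 2 + + n) ≤ℤ p → j ≤ℤ + n → E′ (sucℤ p) ≤ℤ j → E′ p ≤ℤ j
    descend′ p j p≥ j≤ E′≤j with sucℤ p ≟ s
    ... | no p+1≢s = ≤-trans (decreasing p) (descend p j p≥ j≤ (subst (_≤ℤ j) (same p+1≢s) E′≤j))
    ... | yes refl = ≤-by-contradiction λ j<E′ →
      let j<E = ≤-trans j<E′ (decreasing p)
          y≤  = ≤-trans (≤-reflexive drop) (suc-mono E′≤j)
          c   = subst (λ q → 1ℤ + (E q + E (sucℤ s)) ≤ℤ E s + E s) (pred-suc p) crowded
      in <⇒≰ j<E (descend p j p≥ j≤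
           (descend (sucℤ p) j (≤-trans p≥ (i≤suc[i] p)) j≤ (lemma _ _ _ c y≤ j<E)))
      where
      lemma : ∀ x y z → 1ℤ + (x + z) ≤ℤ y + y → y ≤ℤ 1ℤ + j → 1ℤ + j ≤ℤ x → z ≤ℤ j
      lemma x y z h₁ h₂ h₃ = linear (h₁ ⊕ h₂ ⊕ h₂ ⊕ h₃) (solve (x ∷ y ∷ z ∷ j ∷ []))

  fire-Profile : Profile n E′
  fire-Profile = record
    { nonneg  = nonneg′
    ; above   = above′
    ; left    = ≤-trans (decreasing _) left
    ; right   = ≤-trans (decreasing _) right
    ; climb   = climb′
    ; descend = descend′
    }
    where
    nonneg′ : ∀ p → 0ℤ ≤ℤ E′ p
    nonneg′ p with p ≟ s
    ... | yes refl = floor 0ℤ 0ℤ 0ℤ (nonneg _) (nonneg _) ≤-refl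
    ... | no p≢s   = subst (0ℤ ≤ℤ_) (sym (same p≢s)) (nonneg p)

    above′ : ∀ p → 1ℤ + p ≤ℤ E′ p
    above′ p with p ≟ s
    ... | yes refl = floor (1ℤ + pred p) (1ℤ + sucℤ p) (1ℤ + p) (above _) (above _) (≤-reflexive (lemma p))
      where
      lemma : ∀ p → (1ℤ + p) + (1ℤ + p) ≡ (1ℤ + (-1ℤ + p)) + (1ℤ + (1ℤ + p))
      lemma p = solve (p ∷ [])
    ... | no p≢s   = subst (1ℤ + p ≤ℤ_) (sym (same p≢s)) (above p)

  record Tight (j : ℤ) : Set where
    field
      left-≥  : j ≤ℤ E (pred s)
      left-≤  : E (pred s) ≤ℤ j
      right-≥ : 1ℤ + j ≤ℤ E (sucℤ s)
      right-≤ : E (sucℤ s) ≤ℤ 1ℤ + j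

  -- `climb` and `descend` bound the neighbours of s from below by j and 1 + j, while `crowded`
  -- bounds their sum from above by 2j + 1. Hence both bounds are attained.
  tight : ∀ j → - (+ 2 + + n) ≤ℤ s → s ≤ℤ 1ℤ + + n → j ≤ℤ + n → j ≤ℤ + n + s → E s ≡ 1ℤ + j → Tight j
  tight j s≥ s≤ j≤n j≤n+s Es = record
    { left-≥  = l≥
    ; left-≤  = lemmaˡ _ _ _ crowded (≤-reflexive Es) r≥
    ; right-≥ = r≥
    ; right-≤ = lemmaʳ _ _ _ crowded (≤-reflexive Es) l≥
    }
    where
    l≥ : j ≤ℤ E (pred s)
    l≥ = ≤-by-contradiction λ E<j →
      <⇒≰ (≤-reflexive (sym Es)) (climb s j s≤ j≤n+s E<j)
    r≥ : 1ℤ + j ≤ℤ E (sucℤ s)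
    r≥ with E (sucℤ s) ≤⊎> j
    ... | inj₂ j<E = j<E
    ... | inj₁ E≤j = ⊥-elim (<⇒≰ (≤-reflexive (sym Es)) (descend s j s≥ j≤n E≤j))
    lemmaˡ : ∀ x y z → 1ℤ + (x + z) ≤ℤ y + y → y ≤ℤ 1ℤ + j → 1ℤ + j ≤ℤ z → x ≤ℤ j
    lemmaˡ x y z h₁ h₂ h₃ = linear (h₁ ⊕ h₂ ⊕ h₂ ⊕ h₃) (solve (x ∷ y ∷ z ∷ j ∷ []))
    lemmaʳ : ∀ x y z → 1ℤ + (x + z) ≤ℤ y + y → y ≤ℤ 1ℤ + j → j ≤ℤ x → z ≤ℤ 1ℤ + j
    lemmaʳ x y z h₁ h₂ h₃ = linear (h₁ ⊕ h₂ ⊕ h₂ ⊕ h₃) (solve (x ∷ y ∷ z ∷ j ∷ []))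

-- Sums over all chips

interchange : ∀ a b c d → (a + b) + (c + d) ≡ (a + c) + (b + d)
interchange a b c d = solve (a ∷ b ∷ c ∷ d ∷ [])

+-swap : ∀ a b c → a + (b + c) ≡ b + (a + c)
+-swap a b c = solve (a ∷ b ∷ c ∷ [])

ramp : ℤ → ℤ
ramp (+ m)    = + m
ramp -[1+ _ ] = 0ℤ

spike : ℤ → ℤ
spike +0        = 1ℤ
spike +[1+ _ ]  = 0ℤ
spike -[1+ _ ]  = 0ℤ

spike-nonneg : ∀ z → 0ℤ ≤ℤ spike z
spike-nonneg +0       = +≤+ ℕ.z≤n
spike-nonneg +[1+ _ ] = ≤-refl
spike-nonneg -[1+ _ ] = ≤-refl

spike-≢0 : ∀ {z} → z ≢ 0ℤ → spike z ≡ 0ℤ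
spike-≢0 {+0}       z≢0 = contradiction refl z≢0
spike-≢0 {+[1+ _ ]} z≢0 = refl
spike-≢0 { -[1+ _ ]} z≢0 = refl

-- The discrete Laplacian of the ramp is a unit mass at zero. This identity yields both the
-- curvature of `height` and the effect of a firing on it.
ramp-curvature : ∀ z → ramp (sucℤ z) + ramp (pred z) ≡ (ramp z + ramp z) + spike z
ramp-curvature +0       = refl
ramp-curvature +[1+ m ] = lemma (+ m)
  where
  lemma : ∀ x → (1ℤ + (1ℤ + x)) + x ≡ ((1ℤ + x) + (1ℤ + x)) + 0ℤ
  lemma x = solve (x ∷ [])
ramp-curvature -[1+ ℕ.zero ]  = refl
ramp-curvature -[1+ ℕ.suc m ] = refl

_≟ᶜ_ : ∀ {n} → DecidableEquality (Chip n)
neg i ≟ᶜ neg j = map′ (cong neg) (λ { refl → refl }) (i Fin.≟ j)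
neg _ ≟ᶜ pos _ = no λ ()
pos _ ≟ᶜ neg _ = no λ ()
pos i ≟ᶜ pos j = map′ (cong pos) (λ { refl → refl }) (i Fin.≟ j)

sum-const : ∀ m x → sum {m} (λ _ → x) ≡ + m * x
sum-const ℕ.zero    x = refl
sum-const (ℕ.suc m) x = trans (cong (λ y → x + y) (sum-const m x)) (sym (suc-* (+ m) x))

sum-nonneg : ∀ {m} (f : Fin m → ℤ) → (∀ i → 0ℤ ≤ℤ f i) → 0ℤ ≤ℤ sum f
sum-nonneg {ℕ.zero}  f f≥0 = ≤-refl
sum-nonneg {ℕ.suc m} f f≥0 = f≥0 zero ⊕ sum-nonneg (f ∘ suc) (f≥0 ∘ suc)

sum-without : ∀ {m} (f : Fin m → ℤ) i →
              sum f ≡ f i + sum (λ k → if does (k Fin.≟ i) then 0ℤ else f k)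
sum-without f zero    = cong (λ x → f zero + x) (sym (+-identityˡ _))
sum-without f (suc i) = begin
  f zero + sum (f ∘ suc)      ≡⟨ cong (λ y → f zero + y) (sum-without (f ∘ suc) i) ⟩
  f zero + (f (suc i) + rest) ≡⟨ +-swap (f zero) (f (suc i)) rest ⟩
  f (suc i) + (f zero + rest) ∎
  where
  open ≡-Reasoning
  rest = sum (λ k → if does (k Fin.≟ i) then 0ℤ else f (suc k))

module _ {n : ℕ} where

  total : (Chip n → ℤ) → ℤ
  total f = sum (f ∘ neg) + sum (f ∘ pos)

  total-cong : ∀ {f g} → (∀ k → f k ≡ g k) → total f ≡ total g
  total-cong f≗g = cong₂ _+_ (sum-cong-≗ (f≗g ∘ neg)) (sum-cong-≗ (f≗g ∘ pos))

  total-+ : ∀ f g → total (λ k → f k + g k) ≡ total f + total g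
  total-+ f g = trans
    (cong₂ _+_ (∑-distrib-+ (f ∘ neg) (g ∘ neg)) (∑-distrib-+ (f ∘ pos) (g ∘ pos)))
    (interchange (sum (f ∘ neg)) (sum (g ∘ neg)) (sum (f ∘ pos)) (sum (g ∘ pos)))

  total-nonneg : ∀ f → (∀ k → 0ℤ ≤ℤ f k) → 0ℤ ≤ℤ total f
  total-nonneg f f≥0 = sum-nonneg (f ∘ neg) (f≥0 ∘ neg) ⊕ sum-nonneg (f ∘ pos) (f≥0 ∘ pos)

  total-zero : ∀ {f} → (∀ k → f k ≡ 0ℤ) → total f ≡ 0ℤ
  total-zero f≡0 = trans (total-cong f≡0)
    (cong₂ _+_ (trans (sum-const n 0ℤ) (*-zeroʳ (+ n)))
               (trans (sum-const (ℕ.suc n) 0ℤ) (*-zeroʳ (+ ℕ.suc n))))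

  -- A term is zeroed instead of its chip being deleted, so that the index type stays the same and
  -- the operation can be iterated.
  without : Chip n → (Chip n → ℤ) → Chip n → ℤ
  without a f k = if does (k ≟ᶜ a) then 0ℤ else f k

  total-without : ∀ f a → total f ≡ f a + total (without a f)
  total-without f (neg i) =
    trans (cong (_+ sum (f ∘ pos)) (sum-without (f ∘ neg) i))
          (+-assoc (f (neg i)) (sum (without (neg i) f ∘ neg)) (sum (f ∘ pos)))
  total-without f (pos j) =
    trans (cong (λ x → sum (f ∘ neg) + x) (sum-without (f ∘ pos) j))
          (+-swap (sum (f ∘ neg)) (f (pos j)) (sum (without (pos j) f ∘ pos)))

  without-≢ : ∀ {a k} f → k ≢ a → without a f k ≡ f k
  without-≢ {a} {k} f k≢a = cong (if_then 0ℤ else f k) (dec-false (k ≟ᶜ a) k≢a)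

  without-nonneg : ∀ a f → (∀ k → 0ℤ ≤ℤ f k) → ∀ k → 0ℤ ≤ℤ without a f k
  without-nonneg a f f≥0 k with k ≟ᶜ a
  ... | yes _ = ≤-refl
  ... | no  _ = f≥0 k

  total-without₂ : ∀ f {a b} → b ≢ a → total f ≡ (f a + f b) + total (without b (without a f))
  total-without₂ f {a} {b} b≢a = begin
    total f                                        ≡⟨ total-without f a ⟩
    f a + total (without a f)                      ≡⟨ cong (λ y → f a + y) (total-without (without a f) b) ⟩
    f a + (without a f b + total (without b (without a f)))
      ≡⟨ cong (λ x → f a + (x + total (without b (without a f)))) (without-≢ f b≢a) ⟩
    f a + (f b + total (without b (without a f)))  ≡⟨ +-assoc (f a) (f b) _ ⟨
    (f a + f b) + total (without b (without a f))  ∎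
    where open ≡-Reasoning

  total-without₃ : ∀ f {a b k} → b ≢ a → k ≢ a → k ≢ b →
    total f ≡ (f a + f b) + (f k + total (without k (without b (without a f))))
  total-without₃ f {a} {b} {k} b≢a k≢a k≢b = begin
    total f                       ≡⟨ total-without₂ f b≢a ⟩
    (f a + f b) + total g         ≡⟨ cong (λ y → (f a + f b) + y) (total-without g k) ⟩
    (f a + f b) + (g k + total (without k g))
      ≡⟨ cong (λ x → (f a + f b) + (x + total (without k g))) (trans (without-≢ (without a f) k≢b) (without-≢ f k≢a)) ⟩
    (f a + f b) + (f k + total (without k g)) ∎
    where
    open ≡-Reasoning
    g = without b (without a f)

  total-update₂ : ∀ f g {a b} → b ≢ a → (∀ k → k ≢ a → k ≢ b → g k ≡ f k) →
                  total g + (f a + f b) ≡ total f + (g a + g b)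
  total-update₂ f g {a} {b} b≢a g≗f = begin
    total g + (f a + f b)              ≡⟨ cong (_+ (f a + f b)) (total-without₂ g b≢a) ⟩
    ((g a + g b) + rest g) + (f a + f b) ≡⟨ cong (λ x → ((g a + g b) + x) + (f a + f b)) (total-cong same) ⟩
    ((g a + g b) + rest f) + (f a + f b) ≡⟨ lemma (g a + g b) (rest f) (f a + f b) ⟩
    ((f a + f b) + rest f) + (g a + g b) ≡⟨ cong (_+ (g a + g b)) (total-without₂ f b≢a) ⟨
    total f + (g a + g b)              ∎
    where
    open ≡-Reasoning
    rest : (Chip n → ℤ) → ℤ
    rest f = total (without b (without a f))
    same : ∀ k → without b (without a g) k ≡ without b (without a f) k
    same k with k ≟ᶜ b
    ... | yes _ = refl
    ... | no k≢b with k ≟ᶜ a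
    ...   | yes _ = refl
    ...   | no k≢a = g≗f k k≢a k≢b
    lemma : ∀ x y z → (x + y) + z ≡ (z + y) + x
    lemma x y z = solve (x ∷ y ∷ z ∷ [])

-- Triangular numbers extended to the integers

triangle : ℕ → ℕ
triangle ℕ.zero    = 0
triangle (ℕ.suc m) = ℕ.suc m ℕ.+ triangle m

-- T z = z (z + 1) / 2, also for negative z.
T : ℤ → ℤ
T (+ m)    = + triangle m
T -[1+ m ] = + triangle m

T-suc : ∀ z → T (sucℤ z) ≡ sucℤ z + T z
T-suc (+ m)            = refl
T-suc -[1+ ℕ.zero ]    = refl
T-suc -[1+ ℕ.suc m ]   = lemma (+ m) (+ triangle m)
  where
  lemma : ∀ x y → y ≡ - (1ℤ + x) + ((1ℤ + x) + y)
  lemma x y = solve (x ∷ y ∷ [])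

T-nonneg : ∀ z → 0ℤ ≤ℤ T z
T-nonneg (+ m)    = +≤+ ℕ.z≤n
T-nonneg -[1+ m ] = +≤+ ℕ.z≤n

T-≥ : ∀ z → z ≤ℤ T z
T-≥ +0       = ≤-refl
T-≥ +[1+ m ] = +≤+ (ℕ.m≤m+n (ℕ.suc m) (triangle m))
T-≥ -[1+ m ] = -≤+

-- N (1 + m) + (1 + N) m is the initial height at the site m.
T-shift : ∀ N m → T (1ℤ + (N + + m)) ≡
          (T (N - + m) + (1ℤ + + m)) + (N * (1ℤ + + m) + (1ℤ + N) * + m)
T-shift N ℕ.zero = begin
  T (1ℤ + (N + 0ℤ))  ≡⟨ cong (λ x → T (sucℤ x)) (+-identityʳ N) ⟩
  T (sucℤ N)         ≡⟨ T-suc N ⟩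
  sucℤ N + T N       ≡⟨ lemma N (T N) ⟩
  (T N + 1ℤ) + (N * 1ℤ + (1ℤ + N) * 0ℤ)
    ≡⟨ cong (λ x → (T x + 1ℤ) + (N * 1ℤ + (1ℤ + N) * 0ℤ)) (sym (+-identityʳ N)) ⟩
  (T (N - 0ℤ) + 1ℤ) + (N * 1ℤ + (1ℤ + N) * 0ℤ) ∎
  where
  open ≡-Reasoning
  lemma : ∀ N x → (1ℤ + N) + x ≡ (x + 1ℤ) + (N * 1ℤ + (1ℤ + N) * 0ℤ)
  lemma N x = solve (N ∷ x ∷ [])
T-shift N (ℕ.suc m) = begin
  T (1ℤ + (N + (1ℤ + + m)))   ≡⟨ cong (λ x → T (sucℤ x)) (lemma₁ N (+ m)) ⟩
  T (sucℤ (1ℤ + (N + + m)))   ≡⟨ T-suc (1ℤ + (N + + m)) ⟩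
  (1ℤ + (1ℤ + (N + + m))) + T (1ℤ + (N + + m))
    ≡⟨ cong (λ y → (1ℤ + (1ℤ + (N + + m))) + y) (T-shift N m) ⟩
  (1ℤ + (1ℤ + (N + + m))) + ((T (N - + m) + (1ℤ + + m)) + (N * (1ℤ + + m) + (1ℤ + N) * + m))
    ≡⟨ cong (λ x → (1ℤ + (1ℤ + (N + + m))) + ((x + (1ℤ + + m)) + (N * (1ℤ + + m) + (1ℤ + N) * + m))) T-down ⟩
  (1ℤ + (1ℤ + (N + + m))) + ((((N - + m) + T (N - (1ℤ + + m))) + (1ℤ + + m)) + (N * (1ℤ + + m) + (1ℤ + N) * + m))
    ≡⟨ lemma₂ N (+ m) (T (N - (1ℤ + + m))) ⟩
  (T (N - (1ℤ + + m)) + (1ℤ + (1ℤ + + m))) + (N * (1ℤ + (1ℤ + + m)) + (1ℤ + N) * (1ℤ + + m)) ∎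
  where
  open ≡-Reasoning
  lemma₁ : ∀ N x → N + (1ℤ + x) ≡ 1ℤ + (N + x)
  lemma₁ N x = solve (N ∷ x ∷ [])
  lemma₂ : ∀ N x t → (1ℤ + (1ℤ + (N + x))) + ((((N - x) + t) + (1ℤ + x)) + (N * (1ℤ + x) + (1ℤ + N) * x))
         ≡ (t + (1ℤ + (1ℤ + x))) + (N * (1ℤ + (1ℤ + x)) + (1ℤ + N) * (1ℤ + x))
  lemma₂ N x t = solve (N ∷ x ∷ t ∷ [])
  lemma₃ : ∀ N x → 1ℤ + (N - (1ℤ + x)) ≡ N - x
  lemma₃ N x = solve (N ∷ x ∷ [])
  T-down : T (N - + m) ≡ (N - + m) + T (N - (1ℤ + + m))
  T-down = subst (λ z → T z ≡ z + T (N - (1ℤ + + m))) (lemma₃ N (+ m)) (T-suc (N - (1ℤ + + m)))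

-- Height, chip count and excess

module _ {n : ℕ} (c : Config n) where

  height : ℤ → ℤ
  height p = total (λ k → ramp (p - c k))

  count : ℤ → ℤ
  count p = total (λ k → spike (p - c k))

  excess : ℤ → ℤ
  excess p = T (1ℤ + (+ n + p)) - height p

  height-curvature : ∀ p → height (sucℤ p) + height (pred p) ≡ (height p + height p) + count p
  height-curvature p = begin
    height (sucℤ p) + height (pred p)
      ≡⟨ total-+ (λ k → ramp (sucℤ p - c k)) (λ k → ramp (pred p - c k)) ⟨
    total (λ k → ramp (sucℤ p - c k) + ramp (pred p - c k))
      ≡⟨ total-cong (λ k → trans
           (cong₂ (λ x y → ramp x + ramp y) (+-assoc 1ℤ p (- c k)) (+-assoc -1ℤ p (- c k)))
           (ramp-curvature (p - c k))) ⟩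
    total (λ k → (ramp (p - c k) + ramp (p - c k)) + spike (p - c k))
      ≡⟨ total-+ (λ k → ramp (p - c k) + ramp (p - c k)) (λ k → spike (p - c k)) ⟩
    total (λ k → ramp (p - c k) + ramp (p - c k)) + count p
      ≡⟨ cong (_+ count p) (total-+ (λ k → ramp (p - c k)) (λ k → ramp (p - c k))) ⟩
    (height p + height p) + count p ∎
    where open ≡-Reasoning

  excess-curvature : ∀ p → (excess (pred p) + excess (sucℤ p)) + count p ≡ 1ℤ + (excess p + excess p)
  excess-curvature p = begin
    (excess (pred p) + excess (sucℤ p)) + count p
      ≡⟨ lemma₁ (T⁻) (T⁺) (height (pred p)) (height (sucℤ p)) (count p) ⟩
    ((T⁻ + T⁺) - (height (sucℤ p) + height (pred p))) + count p
      ≡⟨ cong₂ (λ x y → (x - y) + count p) T-curvature (height-curvature p) ⟩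
    ((1ℤ + (T⁰ + T⁰)) - ((height p + height p) + count p)) + count p
      ≡⟨ lemma₂ T⁰ (height p) (count p) ⟩
    1ℤ + (excess p + excess p) ∎
    where
    open ≡-Reasoning
    T⁻ = T (1ℤ + (+ n + pred p))
    T⁰ = T (1ℤ + (+ n + p))
    T⁺ = T (1ℤ + (+ n + sucℤ p))
    lemma₁ : ∀ t u x y z → ((t - x) + (u - y)) + z ≡ ((t + u) - (y + x)) + z
    lemma₁ t u x y z = solve (t ∷ u ∷ x ∷ y ∷ z ∷ [])
    lemma₂ : ∀ t x z → ((1ℤ + (t + t)) - ((x + x) + z)) + z ≡ 1ℤ + ((t - x) + (t - x))
    lemma₂ t x z = solve (t ∷ x ∷ z ∷ [])
    shift⁻ : ∀ N p → 1ℤ + (N + (-1ℤ + p)) ≡ N + p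
    shift⁻ N p = solve (N ∷ p ∷ [])
    shift⁺ : ∀ N p → 1ℤ + (N + (1ℤ + p)) ≡ 1ℤ + (1ℤ + (N + p))
    shift⁺ N p = solve (N ∷ p ∷ [])
    lemma₃ : ∀ w t → t + ((1ℤ + (1ℤ + w)) + ((1ℤ + w) + t)) ≡ 1ℤ + (((1ℤ + w) + t) + ((1ℤ + w) + t))
    lemma₃ w t = solve (w ∷ t ∷ [])
    T-curvature : T⁻ + T⁺ ≡ 1ℤ + (T⁰ + T⁰)
    T-curvature = begin
      T⁻ + T⁺
        ≡⟨ cong₂ (λ x y → T x + T y) (shift⁻ (+ n) p) (shift⁺ (+ n) p) ⟩
      T (+ n + p) + T (1ℤ + (1ℤ + (+ n + p)))
        ≡⟨ cong (λ y → T (+ n + p) + y) (T-suc (1ℤ + (+ n + p))) ⟩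
      T (+ n + p) + ((1ℤ + (1ℤ + (+ n + p))) + T⁰)
        ≡⟨ cong (λ x → T (+ n + p) + ((1ℤ + (1ℤ + (+ n + p))) + x)) (T-suc (+ n + p)) ⟩
      T (+ n + p) + ((1ℤ + (1ℤ + (+ n + p))) + ((1ℤ + (+ n + p)) + T (+ n + p)))
        ≡⟨ lemma₃ (+ n + p) (T (+ n + p)) ⟩
      1ℤ + (((1ℤ + (+ n + p)) + T (+ n + p)) + ((1ℤ + (+ n + p)) + T (+ n + p)))
        ≡⟨ cong (λ x → 1ℤ + (x + x)) (sym (T-suc (+ n + p))) ⟩
      1ℤ + (T⁰ + T⁰) ∎

module _ {n : ℕ} (c : Config n) where

  excess-crowded : ∀ p {m} → m ≤ℤ count c p →
                   m + (excess c (pred p) + excess c (sucℤ p)) ≤ℤ 1ℤ + (excess c p + excess c p)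
  excess-crowded p {m} m≤ = begin
    m + (excess c (pred p) + excess c (sucℤ p))          ≤⟨ +-monoˡ-≤ _ m≤ ⟩
    count c p + (excess c (pred p) + excess c (sucℤ p))  ≡⟨ +-comm (count c p) _ ⟩
    (excess c (pred p) + excess c (sucℤ p)) + count c p  ≡⟨ excess-curvature c p ⟩
    1ℤ + (excess c p + excess c p)                       ∎
    where open ≤-Reasoning

  excess-convex : ∀ p → count c p ≤ℤ 1ℤ → excess c p + excess c p ≤ℤ excess c (pred p) + excess c (sucℤ p)
  excess-convex p ≤1 =
    lemma (count c p) (excess c p) (excess c (pred p)) (excess c (sucℤ p)) ≤1
      (≤-reflexive (sym (excess-curvature c p)))
    where
    lemma : ∀ k x y z → k ≤ℤ 1ℤ → 1ℤ + (x + x) ≤ℤ (y + z) + k → x + x ≤ℤ y + z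
    lemma k x y z h₁ h₂ = linear (h₁ ⊕ h₂) (solve (k ∷ x ∷ y ∷ z ∷ []))

  spike-here : ∀ {k p} → c k ≡ p → spike (p - c k) ≡ 1ℤ
  spike-here {p = p} refl = cong spike (+-inverseʳ p)

  spikes-nonneg : ∀ p k → 0ℤ ≤ℤ spike (p - c k)
  spikes-nonneg p k = spike-nonneg (p - c k)

  count-pair : ∀ p {a b} → b ≢ a → c a ≡ p → c b ≡ p → + 2 ≤ℤ count c p
  count-pair p {a} {b} b≢a ca cb = begin
    + 2                        ≤⟨ +-monoʳ-≤ (+ 2) (total-nonneg _ rest≥0) ⟩
    (1ℤ + 1ℤ) + total rest     ≡⟨ cong₂ (λ x y → (x + y) + total rest) (spike-here ca) (spike-here cb) ⟨
    (f a + f b) + total rest   ≡⟨ total-without₂ f b≢a ⟨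
    count c p                  ∎
    where
    open ≤-Reasoning
    f    = λ k → spike (p - c k)
    rest = without b (without a f)
    rest≥0 : ∀ k → 0ℤ ≤ℤ rest k
    rest≥0 = without-nonneg b _ (without-nonneg a f (spikes-nonneg p))

  -- Two chips at a site give `crowded`; a third one makes the second difference of the excess at
  -- most -2, which `Tight` excludes.
  count-triple : ∀ p {a b k} → b ≢ a → k ≢ a → k ≢ b → c a ≡ p → c b ≡ p → c k ≡ p → + 3 ≤ℤ count c p
  count-triple p {a} {b} {k} b≢a k≢a k≢b ca cb ck = begin
    + 3                                ≤⟨ +-monoʳ-≤ (+ 3) (total-nonneg _ rest≥0) ⟩
    + 3 + total rest                   ≡⟨ +-assoc (+ 2) 1ℤ (total rest) ⟩
    (1ℤ + 1ℤ) + (1ℤ + total rest)      ≡⟨ cong₂ (λ x y → (x + y) + (1ℤ + total rest)) (spike-here ca) (spike-here cb) ⟨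
    (f a + f b) + (1ℤ + total rest)    ≡⟨ cong (λ x → (f a + f b) + (x + total rest)) (spike-here ck) ⟨
    (f a + f b) + (f k + total rest)   ≡⟨ total-without₃ f b≢a k≢a k≢b ⟨
    count c p                          ∎
    where
    open ≤-Reasoning
    f    = λ k → spike (p - c k)
    rest = without k (without b (without a f))
    rest≥0 : ∀ k → 0ℤ ≤ℤ rest k
    rest≥0 = without-nonneg k _ (without-nonneg b _ (without-nonneg a f (spikes-nonneg p)))

-- The effect of a firing on the excess

module _ {n : ℕ} {c c′ : Config n} (move : c ⟶ c′) where
  open _⟶_ move

  fired-distinct : b ≢ a
  fired-distinct refl = <-irrefl refl a<b

  -- Before the move both chips contribute `ramp z`, afterwards `ramp (sucℤ z)` and `ramp (pred z)`;
  -- the change is therefore the second difference of the ramp.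
  height-fire : ∀ p → height c′ p ≡ height c p + spike (p - c a)
  height-fire p = cancel (height c′ p) (height c p) (r + r) (spike z) (begin
    height c′ p + (r + r)
      ≡⟨ cong (λ x → height c′ p + (r + ramp (p - x))) same-site ⟩
    height c′ p + (r + ramp (p - c b))
      ≡⟨ total-update₂ (λ k → ramp (p - c k)) (λ k → ramp (p - c′ k)) fired-distinct
           (λ k k≢a k≢b → cong (λ x → ramp (p - x)) (others k k≢a k≢b)) ⟩
    height c p + (ramp (p - c′ a) + ramp (p - c′ b))
      ≡⟨ cong₂ (λ x y → height c p + (ramp x + ramp y)) stepˡ stepʳ ⟩
    height c p + (ramp (sucℤ z) + ramp (pred z))
      ≡⟨ cong (λ x → height c p + x) (ramp-curvature z) ⟩
    height c p + ((r + r) + spike z) ∎)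
    where
    open ≡-Reasoning
    z = p - c a
    r = ramp z
    stepˡ : p - c′ a ≡ sucℤ z
    stepˡ = trans (cong (λ x → p - x) a-left) (lemma p (c a))
      where
      lemma : ∀ p x → p - (-1ℤ + x) ≡ 1ℤ + (p - x)
      lemma p x = solve (p ∷ x ∷ [])
    stepʳ : p - c′ b ≡ pred z
    stepʳ = trans (cong (λ x → p - x) (trans b-right (cong sucℤ (sym same-site)))) (lemma p (c a))
      where
      lemma : ∀ p x → p - (1ℤ + x) ≡ -1ℤ + (p - x)
      lemma p x = solve (p ∷ x ∷ [])
    cancel : ∀ h′ h r s → h′ + r ≡ h + (r + s) → h′ ≡ h + s
    cancel h′ h r s eq = ∙-cancelʳ r h′ (h + s) (trans eq (lemma h r s))
      where
      lemma : ∀ h r s → h + (r + s) ≡ (h + s) + r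
      lemma h r s = solve (h ∷ r ∷ s ∷ [])

  firing : Firing (excess c) (excess c′) (c a)
  firing = record
    { drop    = trans (lemma (T (1ℤ + (+ n + c a))) (height c (c a)))
                  (cong (λ x → 1ℤ + (T (1ℤ + (+ n + c a)) - x)) (sym at-site))
    ; same    = λ {p} p≢s → cong (λ x → T (1ℤ + (+ n + p)) - x) (off-site p≢s)
    ; crowded = lemma₂ (excess c (pred (c a))) (excess c (c a)) (excess c (sucℤ (c a)))
        (excess-crowded c (c a) (count-pair c (c a) fired-distinct refl (sym same-site)))
    }
    where
    at-site : height c′ (c a) ≡ height c (c a) + 1ℤ
    at-site = trans (height-fire (c a)) (cong (λ x → height c (c a) + x) (spike-here c {a} refl))
    off-site : ∀ {p} → p ≢ c a → height c′ p ≡ height c p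
    off-site {p} p≢s = trans (height-fire p)
      (trans (cong (λ x → height c p + x) (spike-≢0 (λ eq → p≢s (i-j≡0⇒i≡j p (c a) eq)))) (+-identityʳ _))
    lemma : ∀ t h → t - h ≡ 1ℤ + (t - (h + 1ℤ))
    lemma t h = solve (t ∷ h ∷ [])
    lemma₂ : ∀ x y z → + 2 + (x + z) ≤ℤ 1ℤ + (y + y) → 1ℤ + (x + z) ≤ℤ y + y
    lemma₂ x y z h = linear h (solve (x ∷ y ∷ z ∷ []))

-- The excess of the initial configuration

module Initial (n : ℕ) where
  E₀ : ℤ → ℤ
  E₀ = excess (initial n)

  E₀-neg : ∀ m → E₀ -[1+ m ] ≡ T (1ℤ + (+ n + -[1+ m ]))
  E₀-neg m = trans (cong (λ x → T (1ℤ + (+ n + -[1+ m ])) - x) (total-zero {n} (height≡0 m))) (+-identityʳ _)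
    where
    height≡0 : ∀ m (k : Chip n) → ramp (-[1+ m ] - initial n k) ≡ 0ℤ
    height≡0 ℕ.zero    (neg _) = refl
    height≡0 (ℕ.suc m) (neg _) = refl
    height≡0 m         (pos _) = refl

  E₀-pos : ∀ m → E₀ (+ m) ≡ T (+ n - + m) + (1ℤ + + m)
  E₀-pos m = begin
    T (1ℤ + (+ n + + m)) - height (initial n) (+ m)
      ≡⟨ cong₂ _-_ (T-shift (+ n) m) height₀ ⟩
    ((T (+ n - + m) + (1ℤ + + m)) + h) - h
      ≡⟨ lemma (T (+ n - + m) + (1ℤ + + m)) h ⟩
    T (+ n - + m) + (1ℤ + + m) ∎
    where
    open ≡-Reasoning
    h = + n * (1ℤ + + m) + (1ℤ + + n) * + m
    lemma : ∀ x h → (x + h) - h ≡ x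
    lemma x h = solve (x ∷ h ∷ [])
    height₀ : height (initial n) (+ m) ≡ h
    height₀ = cong₂ _+_ (trans (sum-const n (+ (m ℕ.+ 1))) (cong (λ x → + n * + x) (ℕ.+-comm m 1)))
                        (trans (sum-const (ℕ.suc n) (+ (m ℕ.+ 0))) (cong (λ x → + ℕ.suc n * + x) (ℕ.+-identityʳ m)))

  -- From z ≤ T z at z = n - m. The excess thus starts above every threshold j ≤ n at the
  -- nonnegative sites, which makes `descend` and `pos-sorted` vacuous there.
  E₀-pos-≥ : ∀ m → 1ℤ + + n ≤ℤ E₀ (+ m)
  E₀-pos-≥ m = subst (1ℤ + + n ≤ℤ_) (sym (E₀-pos m)) (lemma (+ n) (+ m) _ (T-≥ (+ n - + m)))
    where
    lemma : ∀ N x t → N - x ≤ℤ t → 1ℤ + N ≤ℤ t + (1ℤ + x)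
    lemma N x t h = linear h (solve (N ∷ x ∷ t ∷ []))

  E₀-neg-≥ : ∀ m → 1ℤ + (+ n + -[1+ m ]) ≤ℤ E₀ -[1+ m ]
  E₀-neg-≥ m = subst (1ℤ + (+ n + -[1+ m ]) ≤ℤ_) (sym (E₀-neg m)) (T-≥ (1ℤ + (+ n + -[1+ m ])))

  initial-Profile : Profile n E₀
  initial-Profile = record
    { nonneg = nonneg ; above = above ; left = left ; right = right ; climb = climb ; descend = descend }
    where
    nonneg : ∀ p → 0ℤ ≤ℤ E₀ p
    nonneg (+ m)    = ≤-trans (+≤+ ℕ.z≤n) (E₀-pos-≥ m)
    nonneg -[1+ m ] = subst (0ℤ ≤ℤ_) (sym (E₀-neg m)) (T-nonneg (1ℤ + (+ n + -[1+ m ])))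

    above : ∀ p → 1ℤ + p ≤ℤ E₀ p
    above (+ m)    = subst (1ℤ + + m ≤ℤ_) (sym (E₀-pos m))
                       (subst (_≤ℤ T (+ n - + m) + (1ℤ + + m)) (+-identityˡ _) (+-monoˡ-≤ _ (T-nonneg (+ n - + m))))
    above -[1+ m ] = ≤-trans (suc[-[1+m]]≤0 m) (nonneg -[1+ m ])
      where
      suc[-[1+m]]≤0 : ∀ m → 1ℤ + -[1+ m ] ≤ℤ 0ℤ
      suc[-[1+m]]≤0 ℕ.zero    = ≤-refl
      suc[-[1+m]]≤0 (ℕ.suc m) = -≤+

    left : E₀ -[1+ n ] ≤ℤ 0ℤ
    left = ≤-reflexive (trans (E₀-neg n) (cong (λ x → T (1ℤ + x)) eq))
      where
      eq : + n + -[1+ n ] ≡ -1ℤ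
      eq = trans (cong (λ x → + n + x) (neg-suc n)) (lemma (+ n))
        where
        lemma : ∀ N → N + (-1ℤ - N) ≡ -1ℤ
        lemma N = solve (N ∷ [])

    right : E₀ (+ n) ≤ℤ 1ℤ + + n
    right = ≤-reflexive (trans (E₀-pos n)
      (trans (cong (λ x → T x + (1ℤ + + n)) (+-inverseʳ (+ n))) (+-identityˡ _)))

    climb : ∀ p j → p ≤ℤ 1ℤ + + n → j ≤ℤ + n + p → 1ℤ + E₀ (pred p) ≤ℤ j → E₀ p ≤ℤ j
    -- From site m to site 1 + m the triangular term falls by n - m ≥ 0 and the linear term rises by
    -- one.
    climb +[1+ m ] j p≤ j≤ E<j = subst (_≤ℤ j) (sym (E₀-pos (ℕ.suc m)))
      (lemma (+ n) (+ m) (T (+ n - +[1+ m ])) (T (+ n - + m)) j T-down p≤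
        (subst (λ x → 1ℤ + x ≤ℤ j) (E₀-pos m) E<j))
      where
      T-down : T (+ n - + m) ≡ (+ n - + m) + T (+ n - +[1+ m ])
      T-down = subst (λ z → T z ≡ z + T (+ n - +[1+ m ])) (lemma (+ n) (+ m)) (T-suc (+ n - +[1+ m ]))
        where
        lemma : ∀ N x → 1ℤ + (N - (1ℤ + x)) ≡ N - x
        lemma N x = solve (N ∷ x ∷ [])
      lemma : ∀ N x t u j → u ≡ (N - x) + t → 1ℤ + x ≤ℤ 1ℤ + N → 1ℤ + (u + (1ℤ + x)) ≤ℤ j →
              t + (1ℤ + (1ℤ + x)) ≤ℤ j
      lemma N x t u j refl h₁ h₂ = linear (h₁ ⊕ h₂) (solve (N ∷ x ∷ t ∷ j ∷ []))
    -- For p ≤ 0 the premises conflict: the excess at pred p is at least n + p, and j is at most n +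
    -- p.
    climb +0 j p≤ j≤ E<j = ⊥-elim (lemma (+ n) _ j (E₀-neg-≥ 0) j≤ E<j)
      where
      lemma : ∀ N x j → 1ℤ + (N + -1ℤ) ≤ℤ x → j ≤ℤ N + 0ℤ → 1ℤ + x ≤ℤ j → ⊥
      lemma N x j h₁ h₂ h₃ = absurd (h₁ ⊕ h₂ ⊕ h₃) (solve (N ∷ x ∷ j ∷ []))
    climb -[1+ m ] j p≤ j≤ E<j = ⊥-elim (lemma (+ n) -[1+ m ] _ j (E₀-neg-≥ (ℕ.suc m)) j≤ E<j)
      where
      lemma : ∀ N p x j → 1ℤ + (N + (-1ℤ + p)) ≤ℤ x → j ≤ℤ N + p → 1ℤ + x ≤ℤ j → ⊥
      lemma N p x j h₁ h₂ h₃ = absurd (h₁ ⊕ h₂ ⊕ h₃) (solve (N ∷ p ∷ x ∷ j ∷ []))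

    descend : ∀ p j → - (+ 2 + + n) ≤ℤ p → j ≤ℤ + n → E₀ (sucℤ p) ≤ℤ j → E₀ p ≤ℤ j
    descend (+ m) j _ j≤ E≤j = ⊥-elim (<⇒≰ (E₀-pos-≥ (ℕ.suc m)) (≤-trans E≤j j≤))
    descend -[1+ ℕ.zero ] j _ j≤ E≤j = ⊥-elim (<⇒≰ (E₀-pos-≥ 0) (≤-trans E≤j j≤))
    -- For p ≤ -2 both values are triangular numbers, and the step from p to sucℤ p adds 2 + n + p,
    -- which is nonnegative by the lower bound on p.
    descend -[1+ ℕ.suc m ] j p≥ _ E≤j =
      subst (_≤ℤ j) (sym (E₀-neg (ℕ.suc m)))
        (lemma (+ n) p (T w) (T (1ℤ + (+ n + -[1+ m ]))) j T-up p≥ (subst (_≤ℤ j) (E₀-neg m) E≤j))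
      where
      p = -[1+ ℕ.suc m ]
      w = 1ℤ + (+ n + p)
      T-up : T (1ℤ + (+ n + (1ℤ + p))) ≡ (1ℤ + w) + T w
      T-up = subst (λ z → T z ≡ (1ℤ + w) + T w) (lemma (+ n) p) (T-suc w)
        where
        lemma : ∀ N p → 1ℤ + (1ℤ + (N + p)) ≡ 1ℤ + (N + (1ℤ + p))
        lemma N p = solve (N ∷ p ∷ [])
      lemma : ∀ N p t u j → u ≡ (1ℤ + (1ℤ + (N + p))) + t → - (+ 2 + N) ≤ℤ p → u ≤ℤ j → t ≤ℤ j
      lemma N p t u j refl h₁ h₂ = linear (h₁ ⊕ h₂) (solve (N ∷ p ∷ t ∷ j ∷ []))

-- The labelled invariant

-- The second alternatives cover the sites that a chip never reaches; there the
-- excess gives no information.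
record Sorting {n : ℕ} (c : Config n) : Set where
  field
    profile : Profile n (excess c)
    pos-sorted : ∀ j p → 1ℤ + p ≤ℤ + toℕ j → excess c p ≤ℤ + toℕ j ⊎ 1ℤ + (+ n + p) ≤ℤ + toℕ j →
                 1ℤ + p ≤ℤ c (pos j)
    neg-sorted : ∀ i p → 0ℤ ≤ℤ 1ℤ + (+ toℕ i + p) → excess c p ≤ℤ 1ℤ + (+ toℕ i + p) ⊎ + n ≤ℤ + toℕ i + p →
                 1ℤ + c (neg i) ≤ℤ p
    bounded : ∀ k → -[1+ n ] ≤ℤ c k × c k ≤ℤ + n

-- A positive chip moves left only when fired with a larger label. That partner is positive too, so
-- the induction hypothesis applies to it; `smaller-than-neg` serves the mirrored case.
larger-than-pos : ∀ {n j} {b : Chip n} → label {n} (pos j) < label b → ∃ λ j′ → b ≡ pos j′ × 1ℤ + + toℕ j ≤ℤ + toℕ j′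
larger-than-pos {b = pos j′} (+<+ (ℕ.s<s j<j′)) = j′ , refl , +≤+ j<j′

smaller-than-neg : ∀ {n i} {a : Chip n} → label a < label {n} (neg i) → ∃ λ i′ → a ≡ neg i′ × 1ℤ + + toℕ i ≤ℤ + toℕ i′
smaller-than-neg {a = neg i′} (-<- i<i′) = i′ , refl , +≤+ i<i′

-- Preservation of the labelled invariant

module _ {n : ℕ} {c c′ : Config n} (move : c ⟶ c′) (S : Sorting c) where
  open _⟶_ move
  open Sorting S
  open Profile profile
  open Firing (firing move)

  private
    s = c a
    E = excess c
    E′ = excess c′
    N = + n

    data Moved (k : Chip n) : Set where
      left-moved  : k ≡ a → c′ k ≡ pred s → Moved k
      right-moved : k ≡ b → c′ k ≡ sucℤ s → Moved k
      unmoved     : k ≢ a → k ≢ b → c′ k ≡ c k → Moved k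

    moved : ∀ k → Moved k
    moved k with k ≟ᶜ a
    ... | yes refl = left-moved refl a-left
    ... | no k≢a with k ≟ᶜ b
    ...   | yes refl = right-moved refl (trans b-right (cong sucℤ (sym same-site)))
    ...   | no k≢b   = unmoved k≢a k≢b (others k k≢a k≢b)

    -- `Tight` makes the second difference of E at s exactly -1, so the two fired chips are the only
    -- ones there.
    no-bystander : ∀ {j k} → k ≢ a → k ≢ b → Tight profile (firing move) j → E s ≡ 1ℤ + j → c k ≢ s
    no-bystander {j} k≢a k≢b t Es ck =
      lemma (E (pred s)) (E s) (E (sucℤ s)) (excess-crowded c s (count-triple c s (fired-distinct move) k≢a k≢b refl (sym same-site) ck))
        (≤-reflexive Es) left-≥ right-≥
      where
      open Tight t
      lemma : ∀ x y z → + 3 + (x + z) ≤ℤ 1ℤ + (y + y) → y ≤ℤ 1ℤ + j → j ≤ℤ x → 1ℤ + j ≤ℤ z → ⊥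
      lemma x y z h₁ h₂ h₃ h₄ = absurd (h₁ ⊕ h₂ ⊕ h₂ ⊕ h₃ ⊕ h₄) (solve (x ∷ y ∷ z ∷ j ∷ []))

    fired-at : ∀ p {j} → E′ p ≤ℤ j → 1ℤ + j ≤ℤ E p → p ≡ s
    fired-at p E′≤j j<E with p ≟ s
    ... | yes p≡s = p≡s
    ... | no  p≢s = ⊥-elim (<⇒≰ j<E (subst (_≤ℤ _) (same p≢s) E′≤j))

    dropped-to : ∀ {j} → E′ s ≤ℤ j → 1ℤ + j ≤ℤ E s → E s ≡ 1ℤ + j
    dropped-to E′≤j j<E = ≤-antisym (≤-trans (≤-reflexive drop) (suc-mono E′≤j)) j<E

    toℕ≤n : ∀ (j : Fin (ℕ.suc n)) → + toℕ j ≤ℤ N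
    toℕ≤n j = +≤+ (Fin.toℕ≤pred[n] j)

  module Pos (j : Fin (ℕ.suc n)) where
    J = + toℕ j

    -- The premise held before the move, so only a move to the left can do harm. Then the partner
    -- `pos j′` has j′ > j, and `climb` carries the premise over to it at sucℤ p. The partner is
    -- thus beyond sucℤ p, and so is the chip sharing its site, which leaves room for one step left.
    still : ∀ p → 1ℤ + p ≤ℤ J → E p ≤ℤ J ⊎ 1ℤ + (N + p) ≤ℤ J → 1ℤ + p ≤ℤ c′ (pos j)
    still p p<J hyp with moved (pos j)
    ... | unmoved _ _ eq      = subst (1ℤ + p ≤ℤ_) (sym eq) (pos-sorted j p p<J hyp)
    ... | right-moved refl eq = subst (1ℤ + p ≤ℤ_) (sym (trans eq (cong sucℤ same-site)))
                                  (≤-trans (pos-sorted j p p<J hyp) (i≤suc[i] _))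
    ... | left-moved refl eq with larger-than-pos a<b
    ...   | j′ , refl , J<J′ = subst (1ℤ + p ≤ℤ_) (sym eq) (lower (sucℤ p) s
              (subst (1ℤ + sucℤ p ≤ℤ_) (sym same-site)
                (pos-sorted j′ (sucℤ p) (≤-trans (suc-mono p<J) J<J′) (hyp′ hyp))))
      where
      lower : ∀ x y → 1ℤ + x ≤ℤ y → x ≤ℤ -1ℤ + y
      lower x y h = linear h (solve (x ∷ y ∷ []))
      outside : 1ℤ + (N + p) ≤ℤ J → 1ℤ + (N + sucℤ p) ≤ℤ + toℕ j′
      outside h = ≤-trans (lemma N p J h) J<J′
        where
        lemma : ∀ N p J → 1ℤ + (N + p) ≤ℤ J → 1ℤ + (N + (1ℤ + p)) ≤ℤ 1ℤ + J
        lemma N p J h = linear h (solve (N ∷ p ∷ J ∷ []))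
      hyp′ : E p ≤ℤ J ⊎ 1ℤ + (N + p) ≤ℤ J → E (sucℤ p) ≤ℤ + toℕ j′ ⊎ 1ℤ + (N + sucℤ p) ≤ℤ + toℕ j′
      hyp′ (inj₂ h) = inj₂ (outside h)
      hyp′ (inj₁ E≤J) with J ≤⊎> (N + p)
      ... | inj₂ h = inj₂ (outside h)
      ... | inj₁ J≤ = inj₁ (≤-trans
        (climb (sucℤ p) (1ℤ + J) (≤-trans p<J (≤-trans (toℕ≤n j) (i≤suc[i] N)))
          (lemma N p J J≤) (subst (λ q → 1ℤ + E q ≤ℤ 1ℤ + J) (sym (pred-suc p)) (suc-mono E≤J))) J<J′)
        where
        lemma : ∀ N p J → J ≤ℤ N + p → 1ℤ + J ≤ℤ N + (1ℤ + p)
        lemma N p J h = linear h (solve (N ∷ p ∷ J ∷ []))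

    crossing : 1ℤ + s ≤ℤ J → J ≤ℤ N + s → E s ≡ 1ℤ + J → 1ℤ + s ≤ℤ c′ (pos j)
    crossing s<J J≤ Es with moved (pos j)
    ... | right-moved _ eq = ≤-reflexive (sym eq)
    ... | left-moved refl eq with larger-than-pos a<b
    -- The larger partner's threshold was already met, so it had left s, contrary to being fired
    -- there.
    ...   | j′ , refl , J<J′ = ⊥-elim (<⇒≰
              (pos-sorted j′ s (≤-trans s<J (≤-trans (i≤suc[i] J) J<J′)) (inj₁ (≤-trans (≤-reflexive Es) J<J′)))
              (≤-reflexive (sym same-site)))
    crossing s<J J≤ Es | unmoved ≢a ≢b eq =
      subst (1ℤ + s ≤ℤ_) (sym eq) (i<j⇒suc[i]≤j (≤∧≢⇒< s≤ (λ s≡ → no-bystander ≢a ≢b t Es (sym s≡))))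
      where
      s≥ : ∀ N s J → 0ℤ ≤ℤ N → 0ℤ ≤ℤ J → J ≤ℤ N + s → - (+ 2 + N) ≤ℤ s
      s≥ N s J h₀ h₁ h₂ = linear (h₁ ⊕ h₂ ⊕ +≤+ {0} {2} ℕ.z≤n) (solve (N ∷ s ∷ J ∷ []))
      t : Tight profile (firing move) J
      t = tight profile (firing move) J (s≥ N s J (+≤+ ℕ.z≤n) (+≤+ ℕ.z≤n) J≤)
            (≤-trans (i≤suc[i] s) (≤-trans s<J (≤-trans (toℕ≤n j) (i≤suc[i] N)))) (toℕ≤n j) J≤ Es
      -- `Tight` gives E (pred s) ≤ J, so the hypothesis one site to the left already puts the chip
      -- at s or beyond.
      s≤ : s ≤ℤ c (pos j)
      s≤ = subst (_≤ℤ c (pos j)) (suc-pred s)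
             (pos-sorted j (pred s) (subst (_≤ℤ J) (sym (suc-pred s)) (≤-trans (i≤suc[i] s) s<J)) (inj₁ (Tight.left-≤ t)))

    pos-sorted′ : ∀ p → 1ℤ + p ≤ℤ J → E′ p ≤ℤ J ⊎ 1ℤ + (N + p) ≤ℤ J → 1ℤ + p ≤ℤ c′ (pos j)
    pos-sorted′ p p<J (inj₂ h) = still p p<J (inj₂ h)
    pos-sorted′ p p<J (inj₁ E′≤J) with E p ≤⊎> J | J ≤⊎> (N + p)
    ... | inj₁ E≤J | _      = still p p<J (inj₁ E≤J)
    ... | inj₂ _   | inj₂ h = still p p<J (inj₂ h)
    ... | inj₂ J<E | inj₁ J≤ with fired-at p E′≤J J<E
    ...   | refl = crossing p<J J≤ (dropped-to E′≤J J<E)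

  module Neg (i : Fin n) where
    I = + toℕ i

    I<N : 1ℤ + I ≤ℤ N
    I<N = +≤+ (Fin.toℕ<n i)

    -- The mirror image of the positive case: E p is replaced by its gap E p - (1 + p) above the
    -- line of `above`, compared with the threshold I. For this gap `climb` and `descend` exchange
    -- roles, so `descend` now carries the premise to the partner, at pred p.
    still : ∀ p → 0ℤ ≤ℤ 1ℤ + (I + p) → E p ≤ℤ 1ℤ + (I + p) ⊎ N ≤ℤ I + p → 1ℤ + c′ (neg i) ≤ℤ p
    still p p≥ hyp with moved (neg i)
    ... | unmoved _ _ eq     = subst (λ x → 1ℤ + x ≤ℤ p) (sym eq) (neg-sorted i p p≥ hyp)
    ... | left-moved refl eq = subst (λ x → 1ℤ + x ≤ℤ p) (sym eq)
                                 (≤-trans (suc-mono (i≤j⇒pred[i]≤j (≤-refl {s}))) (neg-sorted i p p≥ hyp))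
    ... | right-moved refl eq with smaller-than-neg a<b
    ...   | i′ , refl , I<I′ = subst (λ x → 1ℤ + x ≤ℤ p) (sym eq) (raise s p
              (neg-sorted i′ (pred p) (≤-trans p≥ (lemma I (+ toℕ i′) p I<I′)) (hyp′ hyp)))
      where
      raise : ∀ x y → 1ℤ + x ≤ℤ -1ℤ + y → 1ℤ + (1ℤ + x) ≤ℤ y
      raise x y h = linear h (solve (x ∷ y ∷ []))
      lemma : ∀ I I′ p → 1ℤ + I ≤ℤ I′ → 1ℤ + (I + p) ≤ℤ 1ℤ + (I′ + (-1ℤ + p))
      lemma I I′ p h = linear h (solve (I ∷ I′ ∷ p ∷ []))
      outside : N ≤ℤ I + p → N ≤ℤ + toℕ i′ + pred p
      outside h = lemma′ N I (+ toℕ i′) p h I<I′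
        where
        lemma′ : ∀ N I I′ p → N ≤ℤ I + p → 1ℤ + I ≤ℤ I′ → N ≤ℤ I′ + (-1ℤ + p)
        lemma′ N I I′ p h₁ h₂ = linear (h₁ ⊕ h₂) (solve (N ∷ I ∷ I′ ∷ p ∷ []))
      hyp′ : E p ≤ℤ 1ℤ + (I + p) ⊎ N ≤ℤ I + p → E (pred p) ≤ℤ 1ℤ + (+ toℕ i′ + pred p) ⊎ N ≤ℤ + toℕ i′ + pred p
      hyp′ (inj₂ h) = inj₂ (outside h)
      hyp′ (inj₁ E≤) with N ≤⊎> (I + p)
      ... | inj₁ h = inj₂ (outside h)
      ... | inj₂ J≤N = inj₁ (≤-trans
        (descend (pred p) (1ℤ + (I + p)) (p≥′ N I p p≥ I<N) J≤N
          (subst (λ q → E q ≤ℤ 1ℤ + (I + p)) (sym (suc-pred p)) E≤))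
        (lemma I (+ toℕ i′) p I<I′))
        where
        p≥′ : ∀ N I p → 0ℤ ≤ℤ 1ℤ + (I + p) → 1ℤ + I ≤ℤ N → - (+ 2 + N) ≤ℤ -1ℤ + p
        p≥′ N I p h₁ h₂ = linear (h₁ ⊕ h₂ ⊕ +≤+ {0} {1} ℕ.z≤n) (solve (N ∷ I ∷ p ∷ []))

    J : ℤ
    J = 1ℤ + (I + s)

    crossing : 0ℤ ≤ℤ J → J ≤ℤ N → E s ≡ 1ℤ + J → 1ℤ + c′ (neg i) ≤ℤ s
    crossing 0≤J J≤N Es with moved (neg i)
    ... | left-moved _ eq = ≤-reflexive (trans (cong sucℤ eq) (suc-pred s))
    ... | right-moved refl eq with smaller-than-neg a<b
    ...   | i′ , refl , I<I′ = ⊥-elim (<⇒≰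
              (neg-sorted i′ s (≤-trans 0≤J (≤-trans (i≤suc[i] J) (lemma I (+ toℕ i′) s I<I′)))
                (inj₁ (≤-trans (≤-reflexive Es) (lemma I (+ toℕ i′) s I<I′))))
              ≤-refl)
      where
      lemma : ∀ I I′ s → 1ℤ + I ≤ℤ I′ → 1ℤ + (1ℤ + (I + s)) ≤ℤ 1ℤ + (I′ + s)
      lemma I I′ s h = linear h (solve (I ∷ I′ ∷ s ∷ []))
    crossing 0≤J J≤N Es | unmoved ≢a ≢b eq =
      subst (λ x → 1ℤ + x ≤ℤ s) (sym eq) (i<j⇒suc[i]≤j (≤∧≢⇒< ≤s (no-bystander ≢a ≢b t Es)))
      where
      s≥ : ∀ N I s → 0ℤ ≤ℤ 1ℤ + (I + s) → 1ℤ + I ≤ℤ N → - (+ 2 + N) ≤ℤ s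
      s≥ N I s h₁ h₂ = linear (h₁ ⊕ h₂ ⊕ +≤+ {0} {2} ℕ.z≤n) (solve (N ∷ I ∷ s ∷ []))
      s≤ : ∀ N I s → 0ℤ ≤ℤ I → 1ℤ + (I + s) ≤ℤ N → s ≤ℤ 1ℤ + N
      s≤ N I s h₁ h₂ = linear (h₁ ⊕ h₂ ⊕ +≤+ {0} {2} ℕ.z≤n) (solve (N ∷ I ∷ s ∷ []))
      J≤N+s : ∀ N I s → 1ℤ + I ≤ℤ N → 1ℤ + (I + s) ≤ℤ N + s
      J≤N+s N I s h = linear h (solve (N ∷ I ∷ s ∷ []))
      t : Tight profile (firing move) J
      t = tight profile (firing move) J (s≥ N I s 0≤J I<N) (s≤ N I s (+≤+ ℕ.z≤n) J≤N) J≤N (J≤N+s N I s I<N) Es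
      shift : ∀ I s → 1ℤ + (1ℤ + (I + s)) ≡ 1ℤ + (I + (1ℤ + s))
      shift I s = solve (I ∷ s ∷ [])
      -- `Tight` bounds E (sucℤ s) by 1 + J, which is the threshold of this chip at sucℤ s.
      ≤s : c (neg i) ≤ℤ s
      ≤s = subst₂ _≤ℤ_ (pred-suc (c (neg i))) (pred-suc s) (pred-mono
             (neg-sorted i (sucℤ s) (subst (0ℤ ≤ℤ_) (shift I s) (≤-trans 0≤J (i≤suc[i] J)))
               (inj₁ (subst (E (sucℤ s) ≤ℤ_) (shift I s) (Tight.right-≤ t)))))

    neg-sorted′ : ∀ p → 0ℤ ≤ℤ 1ℤ + (I + p) → E′ p ≤ℤ 1ℤ + (I + p) ⊎ N ≤ℤ I + p → 1ℤ + c′ (neg i) ≤ℤ p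
    neg-sorted′ p p≥ (inj₂ h) = still p p≥ (inj₂ h)
    neg-sorted′ p p≥ (inj₁ E′≤J) with E p ≤⊎> (1ℤ + (I + p)) | N ≤⊎> (I + p)
    ... | inj₁ E≤J | _        = still p p≥ (inj₁ E≤J)
    ... | inj₂ _   | inj₁ h   = still p p≥ (inj₂ h)
    ... | inj₂ J<E | inj₂ J≤N with fired-at p E′≤J J<E
    ...   | refl = crossing p≥ J≤N (dropped-to E′≤J J<E)

  private
    profile′ : Profile n E′
    profile′ = fire-Profile profile (firing move)

    -- A firing at n would need E n ≥ 2 + n to stay within `above` afterwards, but `right` allows
    -- only 1 + n. The left end is excluded likewise, and this confines the chips.
    s≢n : s ≢ N
    s≢n s≡n = <⇒≰ (≤-trans (suc-mono (Profile.above profile′ s)) (≤-reflexive (sym drop)))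
                (subst (λ x → E x ≤ℤ 1ℤ + x) (sym s≡n) right)

    s≢-n-1 : s ≢ -[1+ n ]
    s≢-n-1 s≡ = <⇒≰ (≤-trans (suc-mono (Profile.nonneg profile′ s)) (≤-reflexive (sym drop)))
                  (subst (λ x → E x ≤ℤ 0ℤ) (sym s≡) left)

    bounded′ : ∀ k → -[1+ n ] ≤ℤ c′ k × c′ k ≤ℤ N
    bounded′ k with moved k | bounded k | bounded a
    ... | unmoved _ _ eq   | l , r | _     = subst (-[1+ n ] ≤ℤ_) (sym eq) l , subst (_≤ℤ N) (sym eq) r
    ... | left-moved _ eq  | _     | l , r =
      subst (-[1+ n ] ≤ℤ_) (sym eq) (i<j⇒i≤pred[j] (≤∧≢⇒< l (λ e → s≢-n-1 (sym e)))) ,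
      subst (_≤ℤ N) (sym eq) (i≤j⇒pred[i]≤j r)
    ... | right-moved _ eq | _     | l , r =
      subst (-[1+ n ] ≤ℤ_) (sym eq) (≤-trans l (i≤suc[i] s)) ,
      subst (_≤ℤ N) (sym eq) (i<j⇒suc[i]≤j (≤∧≢⇒< r s≢n))

  fire-Sorting : Sorting c′
  fire-Sorting = record
    { profile = profile′ ; pos-sorted = Pos.pos-sorted′ ; neg-sorted = Neg.neg-sorted′ ; bounded = bounded′ }

-- The invariant along the process

initial-Sorting : ∀ n → Sorting (initial n)
initial-Sorting n = record
  { profile = initial-Profile ; pos-sorted = pos-sorted ; neg-sorted = neg-sorted ; bounded = bounded }
  where
  open Initial n

  pos-sorted : ∀ j p → 1ℤ + p ≤ℤ + toℕ j → E₀ p ≤ℤ + toℕ j ⊎ 1ℤ + (+ n + p) ≤ℤ + toℕ j → 1ℤ + p ≤ℤ 0ℤ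
  pos-sorted j -[1+ m ] _ _ = i<j⇒suc[i]≤j { -[1+ m ]} -<+
  -- At p ≥ 0 both alternatives fail: the excess there exceeds n, and 1 + n + p does too, while j ≤
  -- n.
  pos-sorted j (+ m) _ (inj₁ E≤) =
    ⊥-elim (<⇒≰ (E₀-pos-≥ m) (≤-trans E≤ (+≤+ (Fin.toℕ≤pred[n] j))))
  pos-sorted j (+ m) _ (inj₂ h) =
    ⊥-elim (<⇒≰ (≤-trans (suc-mono (i≤i+j (+ n) (+ m))) h) (+≤+ (Fin.toℕ≤pred[n] j)))

  neg-sorted : ∀ i p → 0ℤ ≤ℤ 1ℤ + (+ toℕ i + p) → E₀ p ≤ℤ 1ℤ + (+ toℕ i + p) ⊎ + n ≤ℤ + toℕ i + p → 0ℤ ≤ℤ p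
  neg-sorted i (+ m) _ _ = +≤+ ℕ.z≤n
  neg-sorted i -[1+ m ] _ (inj₁ E≤) =
    ⊥-elim (lemma (+ n) (+ toℕ i) -[1+ m ] (E₀ -[1+ m ]) (E₀-neg-≥ m) E≤ (+≤+ (Fin.toℕ<n i)))
    where
    lemma : ∀ N I p x → 1ℤ + (N + p) ≤ℤ x → x ≤ℤ 1ℤ + (I + p) → 1ℤ + I ≤ℤ N → ⊥
    lemma N I p x h₁ h₂ h₃ = absurd (h₁ ⊕ h₂ ⊕ h₃) (solve (N ∷ I ∷ p ∷ x ∷ []))
  neg-sorted i -[1+ m ] _ (inj₂ h) =
    ⊥-elim (<⇒≰ (+≤+ (Fin.toℕ<n i)) (≤-trans h (subst (+ toℕ i + -[1+ m ] ≤ℤ_) (+-identityʳ (+ toℕ i)) (+-monoʳ-≤ (+ toℕ i) -≤+))))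

  bounded : ∀ k → -[1+ n ] ≤ℤ initial n k × initial n k ≤ℤ + n
  bounded (neg _) = -≤- ℕ.z≤n , -≤+
  bounded (pos _) = -≤+ , +≤+ ℕ.z≤n

reachable-Sorting : ∀ {n} {c c′ : Config n} → Sorting c → c ⟶* c′ → Sorting c′
reachable-Sorting S ε              = S
reachable-Sorting S (move ◅ moves) = reachable-Sorting (fire-Sorting move S) moves

-- Terminal configurations

label-injective : ∀ {n} {a b : Chip n} → label a ≡ label b → a ≡ b
label-injective {a = neg i} {neg j} eq = cong neg (Fin.toℕ-injective (-[1+-injective eq))
label-injective {a = pos i} {pos j} eq = cong pos (Fin.toℕ-injective (ℕ.suc-injective (+-injective eq)))

can-fire : ∀ {n} {c : Config n} a b → label a < label b → c a ≡ c b → ∃ (c ⟶_)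
can-fire {n} {c} a b a<b ca≡cb = c′ , fire a b a<b ca≡cb a-left b-right others
  where
  c′ : Config n
  c′ k with k ≟ᶜ a | k ≟ᶜ b
  ... | yes _ | _     = pred (c a)
  ... | no _  | yes _ = sucℤ (c b)
  ... | no _  | no _  = c k
  a-left : c′ a ≡ pred (c a)
  a-left with a ≟ᶜ a | a ≟ᶜ b
  ... | yes _  | _ = refl
  ... | no a≢a | _ = contradiction refl a≢a
  b-right : c′ b ≡ sucℤ (c b)
  b-right with b ≟ᶜ a | b ≟ᶜ b
  ... | yes refl | _      = contradiction a<b (<-irrefl refl)
  ... | no _     | yes _  = refl
  ... | no _     | no b≢b = contradiction refl b≢b
  others : ∀ k → k ≢ a → k ≢ b → c′ k ≡ c k
  others k k≢a k≢b with k ≟ᶜ a | k ≟ᶜ b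
  ... | yes k≡a | _       = contradiction k≡a k≢a
  ... | no _    | yes k≡b = contradiction k≡b k≢b
  ... | no _    | no _    = refl

terminal-injective : ∀ {n} {c : Config n} → Terminal c → ∀ {a b} → c a ≡ c b → a ≡ b
terminal-injective terminal {a} {b} ca≡cb with <-cmp (label a) (label b)
... | tri< a<b _ _ = contradiction (can-fire a b a<b ca≡cb) terminal
... | tri≈ _ a≡b _ = label-injective a≡b
... | tri> _ _ b<a = contradiction (can-fire b a b<a (sym ca≡cb)) terminal

module _ {n} {c : Config n} (inj : ∀ {a b} → c a ≡ c b → a ≡ b) where

  count-occupied : ∀ p a → c a ≡ p → count c p ≤ℤ 1ℤ
  count-occupied p a ca≡p = ≤-reflexive (trans (total-without (λ k → spike (p - c k)) a)
    (cong₂ _+_ (spike-here c ca≡p) (total-zero rest≡0)))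
    where
    rest≡0 : ∀ k → without a (λ k → spike (p - c k)) k ≡ 0ℤ
    rest≡0 k with k ≟ᶜ a
    ... | yes _  = refl
    ... | no k≢a = spike-≢0 λ eq → k≢a (inj (trans (sym (i-j≡0⇒i≡j p (c k) eq)) (sym ca≡p)))

  injective-count : ∀ p → count c p ≤ℤ 1ℤ
  injective-count p
    with Fin.any? (λ i → c (neg i) ≟ p) | Fin.any? (λ j → c (pos j) ≟ p)
  ... | yes (i , ci≡p) | _              = count-occupied p (neg i) ci≡p
  ... | no _           | yes (j , cj≡p) = count-occupied p (pos j) cj≡p
  ... | no ¬neg        | no ¬pos        =
    subst (_≤ℤ 1ℤ) (sym (total-zero λ k → spike-≢0 λ eq → vacant k (sym (i-j≡0⇒i≡j p (c k) eq)))) (+≤+ ℕ.z≤n)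
    where
    vacant : ∀ k → c k ≢ p
    vacant (neg i) eq = ¬neg (i , eq)
    vacant (pos j) eq = ¬pos (j , eq)

-- Convex integer sequences

module _ (f : ℕ → ℤ) (convex : ∀ i → f (1 ℕ.+ i) + f (1 ℕ.+ i) ≤ℤ f i + f (2 ℕ.+ i)) where

  private
    rising : ∀ {i} → 1ℤ + f i ≤ℤ f (1 ℕ.+ i) → ∀ k → 1ℤ + f (k ℕ.+ i) ≤ℤ f (1 ℕ.+ k ℕ.+ i)
    rising rise ℕ.zero = rise
    rising {i} rise (ℕ.suc k) =
      lemma (f (k ℕ.+ i)) (f (1 ℕ.+ k ℕ.+ i)) (f (2 ℕ.+ k ℕ.+ i)) (convex (k ℕ.+ i)) (rising rise k)
      where
      lemma : ∀ x y z → y + y ≤ℤ x + z → 1ℤ + x ≤ℤ y → 1ℤ + y ≤ℤ z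
      lemma x y z h₁ h₂ = linear (h₁ ⊕ h₂) (solve (x ∷ y ∷ z ∷ []))

    growth : ∀ {i} → 1ℤ + f i ≤ℤ f (1 ℕ.+ i) → ∀ k → f (1 ℕ.+ i) + + k ≤ℤ f (1 ℕ.+ k ℕ.+ i)
    growth rise ℕ.zero = ≤-reflexive (+-identityʳ _)
    growth {i} rise (ℕ.suc k) =
      lemma (f (1 ℕ.+ i)) (f (1 ℕ.+ k ℕ.+ i)) (f (2 ℕ.+ k ℕ.+ i)) (+ k) (growth rise k) (rising rise (ℕ.suc k))
      where
      lemma : ∀ x y z k → x + k ≤ℤ y → 1ℤ + y ≤ℤ z → x + (1ℤ + k) ≤ℤ z
      lemma x y z k h₁ h₂ = linear (h₁ ⊕ h₂) (solve (x ∷ y ∷ z ∷ k ∷ []))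

  -- If f at i were the first positive value, the increment into i would be at least one, and so
  -- would all later ones by convexity; k steps further f would exceed k. The slack k at the far end
  -- suffices because increments are integers.
  convex-≤0 : f 0 ≤ℤ 0ℤ → ∀ i k → f (k ℕ.+ i) ≤ℤ + k → f i ≤ℤ 0ℤ
  convex-≤0 f0 ℕ.zero    k _ = f0
  convex-≤0 f0 (ℕ.suc i) k f≤k = ≤-by-contradiction λ 0<f →
    lemma (f (1 ℕ.+ i)) (f (1 ℕ.+ k ℕ.+ i)) (+ k) (growth (≤-trans (suc-mono fi≤0) 0<f) k) f≤k′ 0<f
    where
    f≤k′ : f (1 ℕ.+ k ℕ.+ i) ≤ℤ + k
    f≤k′ = subst (λ m → f m ≤ℤ + k) (ℕ.+-suc k i) f≤k
    fi≤0 : f i ≤ℤ 0ℤ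
    fi≤0 = convex-≤0 f0 i (ℕ.suc k) (≤-trans f≤k′ (i≤suc[i] (+ k)))
    lemma : ∀ x y k → x + k ≤ℤ y → y ≤ℤ k → 1ℤ ≤ℤ x → ⊥
    lemma x y k h₁ h₂ h₃ = absurd (h₁ ⊕ h₂ ⊕ h₃) (solve (x ∷ y ∷ k ∷ []))

-- Downward induction on i, with t as fuel: if f i = q > i, then q is already known to be a fixed
-- point, so f takes the value q at both i and q.
inflationary-injective : ∀ {m} (f : Fin m → ℤ) → (∀ {i j} → f i ≡ f j → i ≡ j) →
                         (∀ i → + toℕ i ≤ℤ f i) → (∀ i → f i < + m) → ∀ i → f i ≡ + toℕ i
inflationary-injective {m} f inj i≤f f<m i = below m i (ℕ.m≤m+n m (toℕ i))
  where
  below : ∀ t i → m ≤ t ℕ.+ toℕ i → f i ≡ + toℕ i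
  below ℕ.zero    i m≤i = contradiction (Fin.toℕ<n i) (ℕ.≤⇒≯ m≤i)
  below (ℕ.suc t) i m≤t+i with f i in fi | i≤f i | f<m i
  ... | + q | +≤+ i≤q | +<+ q<m with ℕ.m≤n⇒m<n∨m≡n i≤q
  ...   | inj₂ i≡q = cong +_ (sym i≡q)
  ...   | inj₁ i<q = contradiction i≡k λ eq → ℕ.<-irrefl (trans (cong toℕ eq) (Fin.toℕ-fromℕ< q<m)) i<q
    where
    k = fromℕ< q<m
    i≡k : i ≡ k
    i≡k = inj (trans fi (sym (trans
      (below t k (ℕ.≤-trans m≤t+i (ℕ.≤-trans (ℕ.≤-reflexive (sym (ℕ.+-suc t (toℕ i))))
        (ℕ.+-monoʳ-≤ t (subst (toℕ i ℕ.<_) (sym (Fin.toℕ-fromℕ< q<m)) i<q)))))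
      (cong +_ (Fin.toℕ-fromℕ< q<m)))))

-- Final positions

module _ {n} {c : Config n} (S : Sorting c) (terminal : Terminal c) where
  open Sorting S
  open Profile profile

  private
    E = excess c

    inj : ∀ {a b} → c a ≡ c b → a ≡ b
    inj = terminal-injective terminal

    convex : ∀ p → E p + E p ≤ℤ E (pred p) + E (sucℤ p)
    convex p = excess-convex c p (injective-count inj p)

    convex-from : ∀ x i → E (x + + (1 ℕ.+ i)) + E (x + + (1 ℕ.+ i)) ≤ℤ E (x + + i) + E (x + + (2 ℕ.+ i))
    convex-from x i = subst₂ (λ q r → E (x + + (1 ℕ.+ i)) + E (x + + (1 ℕ.+ i)) ≤ℤ E q + E r)
      (before x (+ i)) (after x (+ i)) (convex (x + + (1 ℕ.+ i)))
      where
      before : ∀ x i → -1ℤ + (x + (1ℤ + i)) ≡ x + i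
      before x i = solve (x ∷ i ∷ [])
      after : ∀ x i → 1ℤ + (x + (1ℤ + i)) ≡ x + (1ℤ + (1ℤ + i))
      after x i = solve (x ∷ i ∷ [])

  excess-neg : ∀ m → m ≤ n → E -[1+ m ] ≤ℤ 0ℤ
  excess-neg m m≤n = subst (λ p → E p ≤ℤ 0ℤ) start
    -- The sequence starts at site -n-1. Site n lies 1 + n + m steps to the right of -m-1, and
    -- `right` gives E n ≤ 1 + n, which is no more than this number of steps.
    (convex-≤0 (λ i → E (-[1+ n ] + + i)) (convex-from -[1+ n ]) left (n ℕ.∸ m) (1 ℕ.+ n ℕ.+ m)
      (≤-trans (≤-reflexive (cong E end)) (≤-trans right (+≤+ (ℕ.s≤s (ℕ.m≤m+n n m))))))
    where
    D = + (n ℕ.∸ m)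
    n≡ : + n ≡ + m + D
    n≡ = cong +_ (sym (ℕ.m+[n∸m]≡n m≤n))
    start : -[1+ n ] + D ≡ -[1+ m ]
    start = trans (cong (_+ D) (trans (neg-suc n) (cong (λ x → pred (- x)) n≡)))
              (trans (lemma (+ m) D) (sym (neg-suc m)))
      where
      lemma : ∀ m d → (-1ℤ - (m + d)) + d ≡ -1ℤ - m
      lemma m d = solve (m ∷ d ∷ [])
    end : -[1+ n ] + ((1ℤ + + n + + m) + D) ≡ + n
    end = trans (cong₂ (λ x y → x + y) (neg-suc n)
            (trans (+-assoc (1ℤ + + n) (+ m) D) (cong (λ x → (1ℤ + + n) + x) (sym n≡)))) (lemma (+ n))
      where
      lemma : ∀ n → (-1ℤ - n) + ((1ℤ + n) + n) ≡ n
      lemma n = solve (n ∷ [])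

  -- Subtracting the line p + 1 keeps E convex and turns the claim into nonpositivity. The sequence
  -- `g` starts at site -1, where `excess-neg` applies, and at index 1 + n it is nonpositive by
  -- `right`.
  excess-pos : ∀ j → j ≤ n → E (pred (+ j)) ≤ℤ + j
  excess-pos j j≤n = i-j≤0⇒i≤j (convex-≤0 g g-convex (subst (_≤ℤ 0ℤ) (sym (+-identityʳ _)) (excess-neg 0 ℕ.z≤n))
    j (1 ℕ.+ n ℕ.∸ j) (≤-trans (subst (λ m → g m ≤ℤ 0ℤ) (sym (ℕ.m∸n+n≡m (ℕ.m≤n⇒m≤1+n j≤n))) (i≤j⇒i-j≤0 right)) (+≤+ ℕ.z≤n)))
    where
    g : ℕ → ℤ
    g i = E (-1ℤ + + i) - + i
    g-convex : ∀ i → g (1 ℕ.+ i) + g (1 ℕ.+ i) ≤ℤ g i + g (2 ℕ.+ i)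
    g-convex i = lemma (E (-1ℤ + + i)) (E (-1ℤ + + (1 ℕ.+ i))) (E (-1ℤ + + (2 ℕ.+ i))) (+ i) (convex-from -1ℤ i)
      where
      lemma : ∀ x y z i → y + y ≤ℤ x + z → (y - (1ℤ + i)) + (y - (1ℤ + i)) ≤ℤ (x - i) + (z - (1ℤ + (1ℤ + i)))
      lemma x y z i h = linear h (solve (x ∷ y ∷ z ∷ i ∷ []))

  terminal-sorted : ∀ k → c k ≡ pred (label k)
  terminal-sorted (pos j) = inflationary-injective (c ∘ pos) (λ eq → pos-inj (inj eq))
    (λ j → subst (_≤ℤ c (pos j)) (suc-pred (+ toℕ j))
      -- The site just left of j is the last one that the chip must have passed.
      (pos-sorted j (pred (+ toℕ j)) (≤-reflexive (suc-pred (+ toℕ j)))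
        (inj₁ (excess-pos (toℕ j) (Fin.toℕ≤pred[n] j)))))
    (λ j → suc[i]≤j⇒i<j (suc-mono (proj₂ (bounded (pos j))))) j
    where
    pos-inj : ∀ {i j} → Chip.pos {n} i ≡ pos j → i ≡ j
    pos-inj refl = refl
  terminal-sorted (neg i) = unreflect (c (neg i)) i (inflationary-injective f
    (λ {i} {j} eq → neg-inj (inj (reflect-injective (c (neg i)) (c (neg j)) eq))) i≤f f<n i)
    where
    -- The reflection x ↦ -2 - x sends the target -i-2 to i and the leftmost site -n-1 to n - 1.
    f : Fin n → ℤ
    f i = - (+ 2 + c (neg i))
    neg-inj : ∀ {i j} → Chip.neg {n} i ≡ neg j → i ≡ j
    neg-inj refl = refl
    reflect-injective : ∀ x y → - (+ 2 + x) ≡ - (+ 2 + y) → x ≡ y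
    reflect-injective x y eq = trans (involutive x) (trans (cong (λ z → - (+ 2 + z)) eq) (sym (involutive y)))
      where
      involutive : ∀ x → x ≡ - (+ 2 + - (+ 2 + x))
      involutive x = solve (x ∷ [])
    unreflect : ∀ x (i : Fin n) → - (+ 2 + x) ≡ + toℕ i → x ≡ pred -[1+ toℕ i ]
    unreflect x i eq = reflect-injective x (pred -[1+ toℕ i ])
      (trans eq (trans (lemma (+ toℕ i)) (cong (λ y → - (+ 2 + pred y)) (sym (neg-suc (toℕ i))))))
      where
      lemma : ∀ i → i ≡ - (+ 2 + (-1ℤ + (-1ℤ - i)))
      lemma i = solve (i ∷ [])
    i≤f : ∀ i → + toℕ i ≤ℤ f i
    i≤f i = lemma (+ toℕ i) (c (neg i)) (subst (1ℤ + c (neg i) ≤ℤ_) (neg-suc (toℕ i))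
      -- At the site -i-1 the threshold 1 + i + p is zero, which `excess-neg` meets.
      (neg-sorted i -[1+ toℕ i ] (≤-reflexive (sym zero≡))
        (inj₁ (subst (E -[1+ toℕ i ] ≤ℤ_) (sym zero≡) (excess-neg (toℕ i) (ℕ.<⇒≤ (Fin.toℕ<n i)))))))
      where
      zero≡ : 1ℤ + (+ toℕ i + -[1+ toℕ i ]) ≡ 0ℤ
      zero≡ = trans (cong (λ x → 1ℤ + (+ toℕ i + x)) (neg-suc (toℕ i))) (lemma (+ toℕ i))
        where
        lemma : ∀ x → 1ℤ + (x + (-1ℤ - x)) ≡ 0ℤ
        lemma x = solve (x ∷ [])
      lemma : ∀ i x → 1ℤ + x ≤ℤ -1ℤ - i → i ≤ℤ - (+ 2 + x)
      lemma i x h = linear h (solve (i ∷ x ∷ []))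
    f<n : ∀ i → f i < + n
    f<n i = suc[i]≤j⇒i<j (lemma (+ n) (c (neg i)) (subst (_≤ℤ c (neg i)) (neg-suc n) (proj₁ (bounded (neg i)))))
      where
      lemma : ∀ n x → -1ℤ - n ≤ℤ x → 1ℤ + - (+ 2 + x) ≤ℤ n
      lemma n x h = linear h (solve (n ∷ x ∷ []))

theorem3p1 : ∀ (n : ℕ) → 1 ≤ n → ∀ (c : Config n) → initial n ⟶* c → Terminal c → ∀ (k : Chip n) → c k ≡ pred (label k)
theorem3p1 n _ c reach terminal = terminal-sorted (reachable-Sorting (initial-Sorting n) reach) terminal
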